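{- Let $n$ and $N$ be positive integers. Suppose that each of the numbers $1,2,\ldots,N$ has one of $n$ colours assigned to it, and that there are no monochromatic solutions to the equation $$x_1+2x_2+x_3=y_1+y_2.$$ Then $N\le e\,(2n)!$.
   Context: A monochromatic solution of an equation, with respect to a colouring of $\{1,\ldots,N\}$, is an assignment of values in $\{1,\ldots,N\}$, all of the same colour, to the variables such that the equation holds; the values of the variables need not be distinct. Here $e$ is the base of the natural logarithm. -}

module Defs where

open import Data.Fin.Base using (Fin; toℕ)
open import Data.Integer.Base as ℤ using (+_; +[1+_])
import Data.Integer.Properties as ℤ
open import Data.Nat.Base as ℕ using (ℕ; zero; suc; _!)
import Data.Nat.Properties as ℕ
import Data.Nat.Solver as ℕ
open import Data.Product.Base using (∃-syntax; _×_; _,_)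
open import Data.Rational.Base
open import Data.Rational.Properties
open import Data.Rational.Solver using (module +-*-Solver)
open import Data.Rational.Unnormalised.Base as ℚᵘ using (mkℚᵘ)
import Data.Rational.Unnormalised.Properties as ℚᵘ
open import Data.Sum.Base using (inj₁; inj₂)
open import Relation.Binary.PropositionalEquality

-- The standard library has no real numbers.  A real is represented by a Cauchy
-- sequence of rationals; these are not quotiented, and are compared only
-- through _≤ℝ_.

IsCauchy : (ℕ → ℚ) → Set
IsCauchy s = ∀ ε → 0ℚ < ε →
  ∃[ K ] (∀ m n → K ℕ.≤ m → K ℕ.≤ n → ∣ s m - s n ∣ < ε)

record ℝ : Set where
  constructor mkℝ
  field
    approx   : ℕ → ℚ
    isCauchy : IsCauchy approx

open ℝ public

infix 4 _≤ℝ_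

-- lim x ≤ lim y, which does not force any termwise inequality; hence the slack ε.
_≤ℝ_ : ℝ → ℝ → Set
x ≤ℝ y = ∀ ε → 0ℚ < ε → ∃[ K ] (∀ k → K ℕ.≤ k → approx x k ≤ approx y k + ε)

const-isCauchy : ∀ q → IsCauchy (λ _ → q)
const-isCauchy q ε 0<ε =
  0 , λ _ _ _ _ → subst (_< ε) (cong ∣_∣ (sym (+-inverseʳ q))) 0<ε

fromℕ : ℕ → ℝ
fromℕ n = mkℝ (λ _ → + n / 1) (const-isCauchy (+ n / 1))

eventually-bounded : ∀ s → IsCauchy s →
  ∃[ K ] ∃[ b ] (Positive b × (∀ m → K ℕ.≤ m → ∣ s m ∣ ≤ b))
eventually-bounded s cs with cs 1ℚ (positive⁻¹ 1ℚ)
... | K , close = K , 1ℚ + ∣ s K ∣ , b-pos , bound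
  where
  b-pos : Positive (1ℚ + ∣ s K ∣)
  b-pos = pos+nonNeg⇒pos 1ℚ ∣ s K ∣ {{∣-∣-nonNeg (s K)}}

  split : ∀ a c → a ≡ (a - c) + c
  split = solve 2 (λ a c → a := (a :- c) :+ c) refl
    where open +-*-Solver

  bound : ∀ m → K ℕ.≤ m → ∣ s m ∣ ≤ 1ℚ + ∣ s K ∣
  bound m K≤m = begin
    ∣ s m ∣                   ≡⟨ cong ∣_∣ (split (s m) (s K)) ⟩
    ∣ (s m - s K) + s K ∣     ≤⟨ ∣p+q∣≤∣p∣+∣q∣ (s m - s K) (s K) ⟩
    ∣ s m - s K ∣ + ∣ s K ∣   ≤⟨ +-monoˡ-≤ ∣ s K ∣ (<⇒≤ (close m K K≤m ℕ.≤-refl)) ⟩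
    1ℚ + ∣ s K ∣              ∎
    where open ≤-Reasoning

∣p*q∣<c*δ : ∀ {p q c δ} → Positive c → ∣ p ∣ ≤ c → ∣ q ∣ < δ → ∣ p * q ∣ < c * δ
∣p*q∣<c*δ {p} {q} {c} {δ} c-pos p≤c q<δ = begin-strict
  ∣ p * q ∣        ≡⟨ ∣p*q∣≡∣p∣*∣q∣ p q ⟩
  ∣ p ∣ * ∣ q ∣    ≤⟨ *-monoʳ-≤-nonNeg ∣ q ∣ {{∣-∣-nonNeg q}} p≤c ⟩
  c * ∣ q ∣        <⟨ *-monoʳ-<-pos c {{c-pos}} q<δ ⟩
  c * δ            ∎
  where open ≤-Reasoning

∣pu-qv∣<aδ+bδ : ∀ {p q u v a b δ} → Positive a → Positive b →
  ∣ p ∣ ≤ a → ∣ v ∣ ≤ b → ∣ p - q ∣ < δ → ∣ u - v ∣ < δ →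
  ∣ p * u - q * v ∣ < a * δ + b * δ
∣pu-qv∣<aδ+bδ {p} {q} {u} {v} {a} {b} {δ} a-pos b-pos p≤a v≤b p-q<δ u-v<δ = begin-strict
  ∣ p * u - q * v ∣
    ≡⟨ cong ∣_∣ (split p q u v) ⟩
  ∣ p * (u - v) + v * (p - q) ∣
    ≤⟨ ∣p+q∣≤∣p∣+∣q∣ (p * (u - v)) (v * (p - q)) ⟩
  ∣ p * (u - v) ∣ + ∣ v * (p - q) ∣
    <⟨ +-mono-< (∣p*q∣<c*δ {p} {u - v} a-pos p≤a u-v<δ) (∣p*q∣<c*δ {v} {p - q} b-pos v≤b p-q<δ) ⟩
  a * δ + b * δ ∎
  where
  open ≤-Reasoning
  split : ∀ p q u v → p * u - q * v ≡ p * (u - v) + v * (p - q)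
  split = solve 4 (λ p q u v →
    p :* u :- q :* v := p :* (u :- v) :+ v :* (p :- q)) refl
    where open +-*-Solver

divide-pos : ∀ {c ε} → Positive c → Positive ε → ∃[ δ ] (0ℚ < δ × c * δ ≡ ε)
divide-pos {c} {ε} c-pos ε-pos =
  c⁻¹ * ε ,
  positive⁻¹ (c⁻¹ * ε) {{pos*pos⇒pos c⁻¹ {{1/pos⇒pos c {{c-pos}}}} ε {{ε-pos}}}} ,
  c*[c⁻¹*ε]≡ε
  where
  c⁻¹ : ℚ
  c⁻¹ = (1/ c) {{pos⇒nonZero c {{c-pos}}}}
  c*[c⁻¹*ε]≡ε : c * (c⁻¹ * ε) ≡ ε
  c*[c⁻¹*ε]≡ε = begin
    c * (c⁻¹ * ε)   ≡⟨ *-assoc c c⁻¹ ε ⟨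
    c * c⁻¹ * ε     ≡⟨ cong (_* ε) (*-inverseʳ c {{pos⇒nonZero c {{c-pos}}}}) ⟩
    1ℚ * ε          ≡⟨ *-identityˡ ε ⟩
    ε               ∎
    where open ≡-Reasoning

-- Projecting with let rather than with keeps Agda from normalising rational
-- arithmetic in the goal.
*-isCauchy : ∀ s t → IsCauchy s → IsCauchy t → IsCauchy (λ k → s k * t k)
*-isCauchy s t cs ct ε 0<ε =
  let A , a , a-pos , s≤a = eventually-bounded s cs
      B , b , b-pos , t≤b = eventually-bounded t ct
      δ , 0<δ , [a+b]δ≡ε  =
        divide-pos {a + b} {ε} (pos+pos⇒pos a {{a-pos}} b {{b-pos}}) (positive 0<ε)
      C , s-close = cs δ 0<δ
      D , t-close = ct δ 0<δ
  in (A ℕ.⊔ B) ℕ.⊔ (C ℕ.⊔ D) , λ m n K≤m K≤n →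
    subst (∣ s m * t m - s n * t n ∣ <_)
      (trans (sym (*-distribʳ-+ δ a b)) [a+b]δ≡ε)
      (∣pu-qv∣<aδ+bδ {s m} {s n} {t m} {t n} a-pos b-pos
        (s≤a m (ℕ.m⊔n≤o⇒m≤o A B (ℕ.m⊔n≤o⇒m≤o (A ℕ.⊔ B) (C ℕ.⊔ D) K≤m)))
        (t≤b n (ℕ.m⊔n≤o⇒n≤o A B (ℕ.m⊔n≤o⇒m≤o (A ℕ.⊔ B) (C ℕ.⊔ D) K≤n)))
        (s-close m n
          (ℕ.m⊔n≤o⇒m≤o C D (ℕ.m⊔n≤o⇒n≤o (A ℕ.⊔ B) (C ℕ.⊔ D) K≤m))
          (ℕ.m⊔n≤o⇒m≤o C D (ℕ.m⊔n≤o⇒n≤o (A ℕ.⊔ B) (C ℕ.⊔ D) K≤n)))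
        (t-close m n
          (ℕ.m⊔n≤o⇒n≤o C D (ℕ.m⊔n≤o⇒n≤o (A ℕ.⊔ B) (C ℕ.⊔ D) K≤m))
          (ℕ.m⊔n≤o⇒n≤o C D (ℕ.m⊔n≤o⇒n≤o (A ℕ.⊔ B) (C ℕ.⊔ D) K≤n))))

infixl 7 _*ℝ_

_*ℝ_ : ℝ → ℝ → ℝ
x *ℝ y = mkℝ (λ k → approx x k * approx y k)
  (*-isCauchy (approx x) (approx y) (isCauchy x) (isCauchy y))

invFact : ℕ → ℚ
invFact k = (+ 1 / k !) {{k ℕ.!≢0}}

-- 1/0! + 1/1! + ⋯ + 1/m!
expSum : ℕ → ℚ
expSum zero    = invFact zero
expSum (suc m) = expSum m + invFact (suc m)

recip : (a : ℕ) .{{_ : ℕ.NonZero a}} → ℚ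
recip a = + 1 / a

toℚᵘ-recip : ∀ a → toℚᵘ (recip (suc a)) ℚᵘ.≃ mkℚᵘ (+ 1) a
toℚᵘ-recip a = toℚᵘ-fromℚᵘ (mkℚᵘ (+ 1) a)

recip-pos : ∀ a .{{_ : ℕ.NonZero a}} → Positive (recip a)
recip-pos a = normalize-pos 1 a

recip-double : ∀ a b .{{_ : ℕ.NonZero a}} .{{_ : ℕ.NonZero b}} →
               2 ℕ.* a ℕ.≤ b → recip b + recip b ≤ recip a
recip-double (suc a) (suc b) 2a≤b = toℚᵘ-cancel-≤ (begin
  toℚᵘ (recip (suc b) + recip (suc b))
    ≃⟨ toℚᵘ-homo-+ (recip (suc b)) (recip (suc b)) ⟩
  toℚᵘ (recip (suc b)) ℚᵘ.+ toℚᵘ (recip (suc b))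
    ≃⟨ ℚᵘ.+-cong (toℚᵘ-recip b) (toℚᵘ-recip b) ⟩
  mkℚᵘ (+ 1) b ℚᵘ.+ mkℚᵘ (+ 1) b
    ≤⟨ ℚᵘ.*≤* (ℤ.+≤+ core) ⟩
  mkℚᵘ (+ 1) a
    ≃⟨ toℚᵘ-recip a ⟨
  toℚᵘ (recip (suc a)) ∎)
  where
  open ℚᵘ.≤-Reasoning
  core : (1 ℕ.* suc b ℕ.+ 1 ℕ.* suc b) ℕ.* suc a ℕ.≤ 1 ℕ.* (suc b ℕ.* suc b)
  core = subst₂ ℕ._≤_ eq (sym (ℕ.*-identityˡ (suc b ℕ.* suc b)))
           (ℕ.*-monoʳ-≤ (suc b) 2a≤b)
    where
    open ℕ.+-*-Solver
    eq : suc b ℕ.* (2 ℕ.* suc a) ≡ (1 ℕ.* suc b ℕ.+ 1 ℕ.* suc b) ℕ.* suc a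
    eq = solve 2 (λ x y → x :* (con 2 :* y)
           := (con 1 :* x :+ con 1 :* x) :* y) refl (suc b) (suc a)

recip-anti-< : ∀ a b .{{_ : ℕ.NonZero a}} .{{_ : ℕ.NonZero b}} →
               a ℕ.< b → recip b < recip a
recip-anti-< (suc a) (suc b) a<b = toℚᵘ-cancel-< (begin-strict
  toℚᵘ (recip (suc b))   ≃⟨ toℚᵘ-recip b ⟩
  mkℚᵘ (+ 1) b           <⟨ ℚᵘ.*<* (ℤ.*-monoˡ-<-pos (+ 1) (ℤ.+<+ a<b)) ⟩
  mkℚᵘ (+ 1) a           ≃⟨ toℚᵘ-recip a ⟨
  toℚᵘ (recip (suc a))   ∎)
  where open ℚᵘ.≤-Reasoning

recip-↧≤ : ∀ ε → .{{Positive ε}} → recip (↧ₙ ε) ≤ ε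
recip-↧≤ ε@(mkℚ +[1+ p ] q _) = toℚᵘ-cancel-≤ (begin
  toℚᵘ (recip (suc q))   ≃⟨ toℚᵘ-recip q ⟩
  mkℚᵘ (+ 1) q           ≤⟨ ℚᵘ.*≤* (ℤ.*-monoʳ-≤-nonNeg (+ suc q) (ℤ.+≤+ (ℕ.s≤s (ℕ.z≤n {p})))) ⟩
  toℚᵘ ε                 ∎)
  where open ℚᵘ.≤-Reasoning

n≤n! : ∀ n → n ℕ.≤ n !
n≤n! zero    = ℕ.z≤n
n≤n! (suc n) = ℕ.m≤m*n (suc n) (n !) {{n ℕ.!≢0}}

expSum-mono : ∀ K d → expSum K ≤ expSum (d ℕ.+ K)
expSum-mono K zero    = ≤-refl
expSum-mono K (suc d) = begin
  expSum K                        ≤⟨ expSum-mono K d ⟩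
  expSum (d ℕ.+ K)                ≡⟨ +-identityʳ _ ⟨
  expSum (d ℕ.+ K) + 0ℚ           ≤⟨ +-monoʳ-≤ (expSum (d ℕ.+ K))
      (<⇒≤ (positive⁻¹ _ {{recip-pos (suc (d ℕ.+ K) !) {{suc (d ℕ.+ K) ℕ.!≢0}}}})) ⟩
  expSum (suc d ℕ.+ K)            ∎
  where open ≤-Reasoning

expSum-tail : ∀ K d → 1 ℕ.≤ K →
  expSum (d ℕ.+ K) + invFact (d ℕ.+ K) ≤ expSum K + invFact K
expSum-tail K zero    1≤K = ≤-refl
expSum-tail K (suc d) 1≤K = begin
  expSum m + invFact (suc m) + invFact (suc m)     ≡⟨ +-assoc (expSum m) (invFact (suc m)) (invFact (suc m)) ⟩
  expSum m + (invFact (suc m) + invFact (suc m))   ≤⟨ +-monoʳ-≤ (expSum m) halve ⟩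
  expSum m + invFact m                             ≤⟨ expSum-tail K d 1≤K ⟩
  expSum K + invFact K                             ∎
  where
  open ≤-Reasoning
  m = d ℕ.+ K
  halve : invFact (suc m) + invFact (suc m) ≤ invFact m
  halve = recip-double (m !) (suc m !) {{m ℕ.!≢0}} {{suc m ℕ.!≢0}}
    (ℕ.*-monoˡ-≤ (m !) (ℕ.s≤s (ℕ.≤-trans 1≤K (ℕ.m≤n+m K d))))

expSum-bounds : ∀ {K m} → 1 ℕ.≤ K → K ℕ.≤ m →
  expSum K ≤ expSum m × expSum m ≤ expSum K + invFact K
expSum-bounds {K} {m} 1≤K K≤m =
  subst (λ i → expSum K ≤ expSum i × expSum i ≤ expSum K + invFact K)
    (ℕ.m∸n+n≡m K≤m) (expSum-mono K d , upper)
  where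
  d = m ℕ.∸ K
  upper : expSum (d ℕ.+ K) ≤ expSum K + invFact K
  upper = begin
    expSum (d ℕ.+ K)                          ≡⟨ +-identityʳ _ ⟨
    expSum (d ℕ.+ K) + 0ℚ                     ≤⟨ +-monoʳ-≤ (expSum (d ℕ.+ K))
      (<⇒≤ (positive⁻¹ _ {{recip-pos ((d ℕ.+ K) !) {{(d ℕ.+ K) ℕ.!≢0}}}})) ⟩
    expSum (d ℕ.+ K) + invFact (d ℕ.+ K)      ≤⟨ expSum-tail K d 1≤K ⟩
    expSum K + invFact K                      ∎
    where open ≤-Reasoning

diff-within : ∀ {l r u v} → u ≤ l + r → l ≤ v → u - v ≤ r
diff-within {l} {r} u≤l+r l≤v =
  subst (_ ≤_) (cancel l r) (+-mono-≤ u≤l+r (neg-antimono-≤ l≤v))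
  where
  cancel : ∀ l r → (l + r) - l ≡ r
  cancel = solve 2 (λ l r → (l :+ r) :- l := r) refl
    where open +-*-Solver

within : ∀ {l r p q} → l ≤ p × p ≤ l + r → l ≤ q × q ≤ l + r → ∣ p - q ∣ ≤ r
within {l} {r} {p} {q} (l≤p , p≤l+r) (l≤q , q≤l+r) with ∣p∣≡p∨∣p∣≡-p (p - q)
... | inj₁ eq = subst (_≤ r) (sym eq) (diff-within p≤l+r l≤q)
... | inj₂ eq = subst (_≤ r) (sym (trans eq (flip p q))) (diff-within q≤l+r l≤p)
  where
  flip : ∀ p q → - (p - q) ≡ q - p
  flip = solve 2 (λ p q → :- (p :- q) := q :- p) refl
    where open +-*-Solver

expSum-isCauchy : IsCauchy expSum
expSum-isCauchy ε 0<ε = K , λ m n K≤m K≤n →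
  ≤-<-trans (within (expSum-bounds 1≤K K≤m) (expSum-bounds 1≤K K≤n)) invFact<ε
  where
  instance
    ε-pos : Positive ε
    ε-pos = positive 0<ε
  K = suc (↧ₙ ε)
  1≤K : 1 ℕ.≤ K
  1≤K = ℕ.s≤s ℕ.z≤n
  invFact<ε : invFact K < ε
  invFact<ε = <-≤-trans
    (recip-anti-< (↧ₙ ε) (K !) {{_}} {{K ℕ.!≢0}} (n≤n! K)) (recip-↧≤ ε)

e : ℝ
e = mkℝ expSum expSum-isCauchy

-- i : Fin N stands for the element suc (toℕ i) of {1, …, N}.
value : ∀ {N} → Fin N → ℕ
value i = suc (toℕ i)

record MonochromaticSolution {n N : ℕ} (χ : Fin N → Fin n) : Set where
  field
    x₁ x₂ x₃ y₁ y₂ : Fin N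
    colour : Fin n
    χx₁ : χ x₁ ≡ colour
    χx₂ : χ x₂ ≡ colour
    χx₃ : χ x₃ ≡ colour
    χy₁ : χ y₁ ≡ colour
    χy₂ : χ y₂ ≡ colour
    equation : value x₁ ℕ.+ 2 ℕ.* value x₂ ℕ.+ value x₃ ≡ value y₁ ℕ.+ value y₂

{-# OPTIONS --safe #-}
module Submission where

open import Defs
open import Data.Fin.Base using (Fin)
open import Data.Nat.Base using (ℕ; NonZero; _*_; _!)
open import Relation.Nullary.Negation.Core using (¬_)

import Data.Fin.Base as Fin
import Data.Fin.Properties as Fin
import Data.Integer.Base as ℤ
import Data.Integer.Properties as ℤ
open import Data.List.Base using (List; []; _∷_; length; filter; allFin)
open import Data.List.Membership.Propositional using (_∈_)
open import Data.List.Membership.Propositional.Properties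
  using (∈-allFin; ∈-filter⁺)
open import Data.List.Properties using (filter-notAll; length-tabulate)
open import Data.List.Relation.Unary.All as All using (All; []; _∷_)
import Data.List.Relation.Unary.All.Properties as All
open import Data.List.Relation.Unary.AllPairs using (AllPairs; []; _∷_)
import Data.List.Relation.Unary.AllPairs.Properties as AllPairs
open import Data.List.Relation.Unary.Any as Any using (here; there)
open import Data.Nat.Base using (zero; suc; _+_; _∸_; _≤_; z≤n; s≤s; s≤s⁻¹)
open import Data.Nat.Properties
import Data.Nat.Solver as ℕ
open import Data.Product.Base using (_×_; _,_)
import Data.Rational.Base as ℚ
import Data.Rational.Properties as ℚ
import Data.Rational.Unnormalised.Base as ℚᵘ
import Data.Rational.Unnormalised.Properties as ℚᵘ
open import Function.Base using (_∘_)
open import Level using (0ℓ)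
open import Relation.Binary.Core using (Rel)
open import Relation.Binary.Definitions using (DecidableEquality)
open import Relation.Binary.PropositionalEquality
open import Relation.Nullary.Decidable.Core using (yes; no; ¬?)
open import Relation.Unary using (Pred; Decidable)

-- If x, y and x + y have one colour, then x + 2y + x = (x + y) + (x + y) is a
-- monochromatic solution; so the colour classes are sum-free and Schur's bound
-- applies.  Give an edge {i < j} of the complete graph on {0, …, N} the colour of
-- j − i: there is no monochromatic triangle, and splitting the neighbours of a
-- vertex by the colour of the connecting edge removes a colour from each part.  The
-- resulting recursive bound already gives N ≤ (2n)!, without the factor e.

length-filter-¬ : ∀ {A : Set} {P : Pred A 0ℓ} (P? : Decidable P) xs →
  length xs ≡ length (filter P? xs) + length (filter (¬? ∘ P?) xs)
length-filter-¬ P? [] = refl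
length-filter-¬ P? (x ∷ xs) with P? x
... | yes _ = cong suc (length-filter-¬ P? xs)
... | no  _ = trans (cong suc (length-filter-¬ P? xs)) (sym (+-suc _ _))

module _ {A C : Set} (_≟_ : DecidableEquality C) where

  -- A pigeonhole count by induction on the palette: split off the fibre of the first colour; what
  -- is left takes its colours in the tail. `R` and `Q` pass to sublists, so the bound on a fibre
  -- may use them.
  length≤fibres : ∀ {R : Rel A 0ℓ} {Q : Pred A 0ℓ} (f : A → C) cs {vs k} →
    AllPairs R vs → All (λ v → Q v × f v ∈ cs) vs →
    (∀ {c ws} → c ∈ cs → AllPairs R ws → All (λ w → Q w × f w ≡ c) ws → length ws ≤ k) →
    length vs ≤ length cs * k
  length≤fibres f []       _  []             _ = z≤n
  length≤fibres f []       _  ((_ , ()) ∷ _) _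
  length≤fibres {Q = Q} f (c ∷ cs) {vs} {k} rs qs fibre≤k = begin
    length vs
      ≡⟨ length-filter-¬ c? vs ⟩
    length (filter c? vs) + length (filter (¬? ∘ c?) vs)
      ≤⟨ +-mono-≤
           (fibre≤k (here refl) (AllPairs.filter⁺ c? rs) fibre)
           (length≤fibres f cs (AllPairs.filter⁺ (¬? ∘ c?) rs) rest (fibre≤k ∘ there)) ⟩
    k + length cs * k
      ∎
    where
    open ≤-Reasoning
    c? : Decidable (λ v → f v ≡ c)
    c? v = f v ≟ c
    fibre : All (λ v → Q v × f v ≡ c) (filter c? vs)
    fibre = All.zipWith (λ ((q , _) , fv≡c) → q , fv≡c)
      (All.filter⁺ c? qs , All.all-filter c? vs)
    rest : All (λ v → Q v × f v ∈ cs) (filter (¬? ∘ c?) vs)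
    rest = All.zipWith (λ ((q , fv∈) , fv≢c) → q , Any.tail fv≢c fv∈)
      (All.filter⁺ (¬? ∘ c?) qs , All.all-filter (¬? ∘ c?) vs)

-- The values 1, 2, 5, 16, 65, ..., that is, `m !` times `expSum m`: one vertex, plus one set of
-- neighbours for each of `suc m` colours.
ramseyBound : ℕ → ℕ
ramseyBound zero    = 1
ramseyBound (suc m) = suc (suc m * ramseyBound m)

module TriangleFree {A C : Set} (_≟_ : DecidableEquality C)
  (_≺_ : Rel A 0ℓ) (κ : A → A → C)
  (no-triangle : ∀ {x y z} → x ≺ y → y ≺ z → κ x y ≡ κ x z → κ y z ≢ κ x y)
  where

  -- With the order built in, `AllPairs (Edge cs) vs` describes an increasing list of vertices
  -- forming a clique coloured from `cs`.
  Edge : List C → Rel A _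
  Edge cs x y = x ≺ y × κ x y ∈ cs

  without : C → List C → List C
  without c = filter (λ d → ¬? (d ≟ c))

  length-without : ∀ {c cs m} → c ∈ cs → length cs ≤ suc m → length (without c cs) ≤ m
  length-without c∈cs cs≤1+m = s≤s⁻¹ (≤-trans
    (filter-notAll _ _ (Any.map (λ c≡d d≢c → d≢c (sym c≡d)) c∈cs)) cs≤1+m)

  -- An edge of colour `c` inside `ws` would close a monochromatic triangle with `v`.
  neighbours-avoid : ∀ {cs v c ws} → AllPairs (Edge cs) ws →
    All (λ w → v ≺ w × κ v w ≡ c) ws → AllPairs (Edge (without c cs)) ws
  neighbours-avoid []         []                     = []
  neighbours-avoid (es ∷ ess) ((v≺w , κvw≡c) ∷ v≺ws) =
    All.zipWith
      (λ ((w≺x , κwx∈cs) , _ , κvx≡c) → w≺x , ∈-filter⁺ _ κwx∈cs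
        (λ κwx≡c → no-triangle v≺w w≺x
          (trans κvw≡c (sym κvx≡c)) (trans κwx≡c (sym κvw≡c))))
      (es , v≺ws)
    ∷ neighbours-avoid ess v≺ws

  length≤ramseyBound : ∀ m {cs vs} → length cs ≤ m → AllPairs (Edge cs) vs →
    length vs ≤ ramseyBound m
  length≤ramseyBound m    _ [] = z≤n
  -- Without colours there are no edges, hence at most one vertex.
  length≤ramseyBound zero _ ([] ∷ _) = ≤-refl
  length≤ramseyBound zero {[]} _ (((_ , ()) ∷ _) ∷ _)
  length≤ramseyBound zero {_ ∷ _} () _
  length≤ramseyBound (suc m) {cs} {v ∷ vs} cs≤1+m (es ∷ ess) = s≤s (begin
    length vs
      -- The first vertex `v` is joined to all others, and `es` records this with `v ≺_` in the role
      -- of `Q`. Each fibre of `κ v` is a clique lacking one colour.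
      ≤⟨ length≤fibres _≟_ (κ v) cs ess es (λ c∈cs ess′ v≺ws →
           length≤ramseyBound m (length-without c∈cs cs≤1+m) (neighbours-avoid ess′ v≺ws)) ⟩
    length cs * ramseyBound m
      ≤⟨ *-monoˡ-≤ (ramseyBound m) cs≤1+m ⟩
    suc m * ramseyBound m
      ∎)
    where open ≤-Reasoning

ramseyBound≤1+[2m]! : ∀ m → ramseyBound m ≤ suc ((2 * m) !)
ramseyBound≤1+[2m]! zero    = s≤s z≤n
ramseyBound≤1+[2m]! (suc m) = s≤s (begin
  suc m * ramseyBound m            ≤⟨ *-monoʳ-≤ (suc m) (ramseyBound≤1+[2m]! m) ⟩
  -- Absorbing the 1 into a second `F` supplies the 2 that turns `suc m` into the factor
  -- `2 + 2 * m`. The factor `suc (2 * m)` still missing is at least 1 and is inserted two lines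
  -- below.
  suc m * (1 + F)                  ≤⟨ *-monoʳ-≤ (suc m) (+-monoˡ-≤ F (1≤n! (2 * m))) ⟩
  suc m * (F + F)                  ≡⟨ double (suc m) F ⟩
  2 * suc m * F                    ≤⟨ *-monoʳ-≤ (2 * suc m) (m≤m+n F (2 * m * F)) ⟩
  2 * suc m * (suc (2 * m)) !      ≡⟨ cong (_* suc (2 * m) !) (*-suc 2 m) ⟩
  (2 + 2 * m) !                    ≡⟨ cong _! (*-suc 2 m) ⟨
  (2 * suc m) !                    ∎)
  where
  open ≤-Reasoning
  F = (2 * m) !
  double : ∀ a b → a * (b + b) ≡ 2 * a * b
  double = solve 2 (λ a b → a :* (b :+ b) := con 2 :* a :* b) refl
    where open ℕ.+-*-Solver

module _ {n M : ℕ} (χ : Fin (suc M) → Fin n) where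

  -- For `i < j` the index is j - i - 1, because `value` adds 1 back. Truncated subtraction makes
  -- the function total: other pairs get index 0.
  gap : Fin (suc (suc M)) → Fin (suc (suc M)) → Fin (suc M)
  gap i j = Fin.fromℕ< (s≤s (≤-trans
    (∸-monoʳ-≤ (Fin.toℕ j) (s≤s (z≤n {Fin.toℕ i})))
    (∸-monoˡ-≤ 1 (Fin.toℕ≤pred[n] j))))

  i+value-gap : ∀ {i j} → i Fin.< j → Fin.toℕ i + value (gap i j) ≡ Fin.toℕ j
  i+value-gap {i} {j} i<j = begin
    Fin.toℕ i + value (gap i j)
      ≡⟨ cong (λ d → Fin.toℕ i + suc d) (Fin.toℕ-fromℕ< _) ⟩
    Fin.toℕ i + suc (Fin.toℕ j ∸ suc (Fin.toℕ i))
      ≡⟨ +-suc (Fin.toℕ i) _ ⟩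
    suc (Fin.toℕ i) + (Fin.toℕ j ∸ suc (Fin.toℕ i))
      ≡⟨ m+[n∸m]≡n i<j ⟩
    Fin.toℕ j
      ∎
    where open ≡-Reasoning

  -- Adding `i` to both sides lets the gaps telescope without handling truncated subtraction again.
  -- A triangle thus becomes a Schur triple.
  value-gap-+ : ∀ {i j k} → i Fin.< j → j Fin.< k →
    value (gap i j) + value (gap j k) ≡ value (gap i k)
  value-gap-+ {i} {j} {k} i<j j<k = +-cancelˡ-≡ (Fin.toℕ i) _ _ (begin
    Fin.toℕ i + (value (gap i j) + value (gap j k))   ≡⟨ +-assoc (Fin.toℕ i) _ _ ⟨
    Fin.toℕ i + value (gap i j) + value (gap j k)     ≡⟨ cong (_+ value (gap j k)) (i+value-gap i<j) ⟩
    Fin.toℕ j + value (gap j k)                       ≡⟨ i+value-gap j<k ⟩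
    Fin.toℕ k                                         ≡⟨ i+value-gap (<-trans i<j j<k) ⟨
    Fin.toℕ i + value (gap i k)                       ∎)
    where open ≡-Reasoning

  schur⇒solution : ∀ {x y z} → value x + value y ≡ value z →
    χ x ≡ χ z → χ y ≡ χ x → MonochromaticSolution χ
  schur⇒solution {x} {y} {z} x+y≡z χx≡χz χy≡χx = record
    { x₁ = x ; x₂ = y ; x₃ = x ; y₁ = z ; y₂ = z
    ; colour = χ x
    ; χx₁ = refl ; χx₂ = χy≡χx ; χx₃ = refl ; χy₁ = sym χx≡χz ; χy₂ = sym χx≡χz
    ; equation = trans (regroup (value x) (value y)) (cong₂ _+_ x+y≡z x+y≡z)
    }
    where
    regroup : ∀ a b → a + 2 * b + a ≡ (a + b) + (a + b)
    regroup = solve 2 (λ a b → a :+ con 2 :* b :+ a := (a :+ b) :+ (a :+ b)) refl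
      where open ℕ.+-*-Solver

  schur : ¬ MonochromaticSolution χ → suc M ≤ (2 * n) !
  -- There is one vertex more than there are differences; it cancels against the successor in the
  -- bound on `ramseyBound`.
  schur ¬sol = s≤s⁻¹ (begin
    suc (suc M)                       ≡⟨ length-tabulate {n = suc (suc M)} (λ i → i) ⟨
    length (allFin (suc (suc M)))     ≤⟨ length≤ramseyBound n (≤-reflexive (length-tabulate {n = n} (λ c → c)))
                                           (AllPairs.tabulate⁺-< (λ i<j → i<j , ∈-allFin _)) ⟩
    ramseyBound n                     ≤⟨ ramseyBound≤1+[2m]! n ⟩
    suc ((2 * n) !)                   ∎)
    where
    open ≤-Reasoning
    open TriangleFree Fin._≟_ Fin._<_ (λ i j → χ (gap i j))
      (λ i<j j<k χij≡χik χjk≡χij →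
        ¬sol (schur⇒solution (value-gap-+ i<j j<k) χij≡χik χjk≡χij))

/1-mono-≤ : ∀ {a b} → a ≤ b → (ℤ.+ a ℚ./ 1) ℚ.≤ (ℤ.+ b ℚ./ 1)
/1-mono-≤ {a} {b} a≤b = ℚ.toℚᵘ-cancel-≤ (begin
  ℚ.toℚᵘ (ℤ.+ a ℚ./ 1)     ≃⟨ ℚ.toℚᵘ-fromℚᵘ (ℚᵘ.mkℚᵘ (ℤ.+ a) 0) ⟩
  ℚᵘ.mkℚᵘ (ℤ.+ a) 0        ≤⟨ ℚᵘ.*≤* (ℤ.*-monoʳ-≤-nonNeg (ℤ.+ 1) (ℤ.+≤+ a≤b)) ⟩
  ℚᵘ.mkℚᵘ (ℤ.+ b) 0        ≃⟨ ℚ.toℚᵘ-fromℚᵘ (ℚᵘ.mkℚᵘ (ℤ.+ b) 0) ⟨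
  ℚ.toℚᵘ (ℤ.+ b ℚ./ 1)     ∎)
  where open ℚᵘ.≤-Reasoning

-- The term 1/0! alone gives 1, and `expSum` is monotone.
1≤expSum : ∀ k → ℚ.1ℚ ℚ.≤ expSum k
1≤expSum k = subst (λ i → ℚ.1ℚ ℚ.≤ expSum i) (+-identityʳ k) (expSum-mono 0 k)

fromℕ≤e*fromℕ : ∀ {a b} → a ≤ b → fromℕ a ≤ℝ e *ℝ fromℕ b
-- The inequality holds termwise from the first partial sum on, so the threshold is 0 and `ε` is
-- simply added at the end.
fromℕ≤e*fromℕ {a} {b} a≤b ε 0<ε = 0 , λ k _ → begin
  ℤ.+ a ℚ./ 1                              ≤⟨ /1-mono-≤ a≤b ⟩
  b/1                                      ≡⟨ ℚ.*-identityˡ b/1 ⟨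
  ℚ.1ℚ ℚ.* b/1                             ≤⟨ ℚ.*-monoʳ-≤-nonNeg b/1 {{ℚ.normalize-nonNeg b 1}} (1≤expSum k) ⟩
  expSum k ℚ.* b/1                         ≡⟨ ℚ.+-identityʳ _ ⟨
  expSum k ℚ.* b/1 ℚ.+ ℚ.0ℚ                ≤⟨ ℚ.+-monoʳ-≤ (expSum k ℚ.* b/1) (ℚ.<⇒≤ 0<ε) ⟩
  expSum k ℚ.* b/1 ℚ.+ ε                   ∎
  where
  open ℚ.≤-Reasoning
  b/1 = ℤ.+ b ℚ./ 1

theorem7 : (n N : ℕ) .{{_ : NonZero n}} .{{_ : NonZero N}} →
    (χ : Fin N → Fin n) → ¬ MonochromaticSolution χ →
    fromℕ N ≤ℝ e *ℝ fromℕ ((2 * n) !)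
theorem7 n (suc M) χ ¬sol = fromℕ≤e*fromℕ (schur χ ¬sol)
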